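{- Let $k,n\ge1$ be integers. For a function $f:[k]\to[n]$ put $w(f)=\prod_{i=1}^n x_{|f^{ -1}(i)|}$. Then $$\Delta_k x_0^{n}=\sum_{f:[k]\to[n]}w(f).$$ Equivalently, for every colored set $(V,\kappa)$ (a finite totally ordered set $V$ with a function $\kappa:V\to\{0,1,\dots,k\}$), the coefficient $(\Delta_kx_0^n)[V,\kappa]$ is equal to the number of pairs $(f,h)$ where $f:[k]\to[n]$ is a function and $h:[n]\to V$ is a bijection such that $\kappa(h(j))=|f^{ -1}(j)|$ for all $j\in[n]$.
   Context: $[n]=\{1,\dots,n\}$. For $m\ge1$, $\mathcal{D}_m=\sum_{j=0}^{m-1}x_{j+1}\partial_j$ with $\partial_j=\partial/\partial x_j$, acting from power series in $x_0,\dots,x_{m-1}$ to power series in $x_0,\dots,x_m$, and $\Delta_k=\mathcal{D}_k\mathcal{D}_{k-1}\cdots\mathcal{D}_1$. For a series written in exponential form $G(x_0,\dots,x_k)=\sum_{\mathbf{m}}g_{\mathbf{m}}\frac{x_0^{m_0}\cdots x_k^{m_k}}{m_0!\cdots m_k!}$, the coefficient $G[V,\kappa]$ is $g_{\mathbf m}$ with $m_i=|\kappa^{ -1}(i)|$. -}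

module Defs where

open import Algebra.Bundles using (CommutativeRing; Semiring; RawSemiring)
import Algebra.Definitions.RawSemiring as RawSemiringDefs
open RawSemiringDefs using (_×_; sum; product)
open import Data.Bool.Base using (if_then_else_)
open import Data.Fin.Base using (Fin; zero; suc; toℕ; fromℕ<; finToFun)
open import Data.Fin.Properties using (_≟_)
open import Data.Fin.Subset using (Subset; ∣_∣)
open import Data.Fin.Subset.Properties using (∣p∣≤n)
import Data.Nat.Base as ℕ
open import Data.Nat.Base using (ℕ; zero; suc; _∸_; _!; s≤s)
import Data.Nat.Properties as ℕₚ
import Data.Product.Base as Product
open import Data.Vec.Base using (Vec; []; _∷_; lookup; replicate; tabulate; map; foldr′; init; last; _[_]≔_; _[_]%=_)
open import Data.Vec.Properties using (≡-dec)
open import Function.Base using (_∘_)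
open import Function.Bundles using (Inverse; _↔_; _⤖_; Bijection)
open import Level using (Level; _⊔_) renaming (suc to lsuc)
open import Relation.Binary.Bundles using (Setoid)
open import Relation.Binary.Core using (Rel)
open import Relation.Binary.PropositionalEquality using (_≡_; setoid; refl; sym; trans)
open import Relation.Binary.Structures using (IsTotalOrder)
open import Relation.Nullary.Decidable.Core using (does)

private
  variable
    k n : ℕ

fibre : (Fin k → Fin n) → Fin n → Subset k
fibre f i = tabulate λ j → does (f j ≟ i)

-- |f⁻¹(i)| as an index in {0,…,k}.
fibreSize : (Fin k → Fin n) → Fin n → Fin (suc k)
fibreSize f i = fromℕ< (s≤s (∣p∣≤n (fibre f i)))

record ColoredSet (v ℓ : Level) (k : ℕ) : Set (lsuc (v ⊔ ℓ)) where
  field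
    V            : Set v
    _≤_          : Rel V ℓ
    isTotalOrder : IsTotalOrder _≡_ _≤_
    size         : ℕ
    enum         : Fin size ↔ V
    κ            : V → Fin (suc k)

  -- The vector (|κ⁻¹(0)|, …, |κ⁻¹(k)|).
  multiplicities : Vec ℕ (suc k)
  multiplicities = tabulate λ i → ∣ fibre (κ ∘ Inverse.to enum) i ∣

module _ {v ℓ : Level} {k : ℕ} (n : ℕ) (C : ColoredSet v ℓ k) where
  open ColoredSet C

  record CompatiblePair : Set v where
    field
      f          : Fin k → Fin n
      h          : Fin n ⤖ V
      compatible : ∀ j → toℕ (κ (Bijection.to h j)) ≡ ∣ fibre f j ∣

  -- Pairs are identified when their underlying functions agree pointwise;
  -- the proofs they carry are irrelevant.
  compatiblePairs : Setoid v v
  compatiblePairs = record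
    { Carrier = CompatiblePair
    ; _≈_ = λ p q → (∀ i → f p i ≡ f q i)
                    Product.× (∀ j → Bijection.to (h p) j ≡ Bijection.to (h q) j)
    ; isEquivalence = record
      { refl  = (λ _ → refl) Product., (λ _ → refl)
      ; sym   = λ e → (sym ∘ Product.proj₁ e) Product., (sym ∘ Product.proj₂ e)
      ; trans = λ d e → (λ i → trans (Product.proj₁ d i) (Product.proj₁ e i))
                        Product., (λ j → trans (Product.proj₂ d j) (Product.proj₂ e j))
      }
    }
    where open CompatiblePair

HasCardinality : ∀ {a ℓ} → Setoid a ℓ → ℕ → Set (a ⊔ ℓ)
HasCardinality S N = Inverse (setoid (Fin N)) S

module PowerSeries {c ℓ : Level} (R : CommutativeRing c ℓ) where

  open CommutativeRing R using (Carrier; _≈_; _+_; _*_; 0#; 1#; semiring)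
  open Semiring semiring using (rawSemiring)

  -- Power series over R in x₀,…,xₙ₋₁: the value at (m₀,…,mₙ₋₁) is the
  -- ordinary coefficient of x₀^m₀ ⋯ xₙ₋₁^mₙ₋₁.
  Series : ℕ → Set c
  Series n = Vec ℕ n → Carrier

  monomial : Vec ℕ n → Series n
  monomial e m = if does (≡-dec ℕₚ._≟_ m e) then 1# else 0#

  -- convolve K m = Σ K a b over all a, b with a + b = m componentwise.
  convolve : (Vec ℕ n → Vec ℕ n → Carrier) → Series n
  convolve K []      = K [] []
  convolve K (d ∷ m) = sum rawSemiring {suc d} λ i →
    convolve (λ a b → K (toℕ i ∷ a) ((d ∸ toℕ i) ∷ b)) m

  seriesRawSemiring : ℕ → RawSemiring c ℓ
  seriesRawSemiring n = record
    { Carrier = Series n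
    ; _≈_     = λ F G → ∀ m → F m ≈ G m
    ; _+_     = λ F G m → F m + G m
    ; _*_     = λ F G → convolve λ a b → F a * G b
    ; 0#      = λ _ → 0#
    ; 1#      = monomial (replicate n 0)
    }

  x : Fin n → Series n
  x {n} i = monomial (replicate n 0 [ i ]≔ 1)

  ∂ : Fin n → Series n → Series n
  ∂ j F m = _×_ rawSemiring (suc (lookup m j)) (F (m [ j ]%= suc))

  -- The inclusion of series in x₀,…,xₙ₋₁ into series in x₀,…,xₙ.
  include : Series n → Series (suc n)
  include F m = if does (last m ℕₚ.≟ 0) then F (init m) else 0#

  𝒟 : (m : ℕ) → Series m → Series (suc m)
  𝒟 m F = sum (seriesRawSemiring (suc m)) λ (j : Fin m) → x (suc j) · include (∂ j F)
    where open RawSemiring (seriesRawSemiring (suc m)) using () renaming (_*_ to _·_)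

  Δ : (k : ℕ) → Series 1 → Series (suc k)
  Δ zero    F = F
  Δ (suc k) F = 𝒟 (suc k) (Δ k F)

  w : (Fin k → Fin n) → Series (suc k)
  w {k} f = product (seriesRawSemiring (suc k)) λ i → x (fibreSize f i)

  -- finToFun is the library's bijection between Fin (n ^ k) and the
  -- functions Fin k → Fin n.
  sumOverFunctions : ∀ {N} k n → ((Fin k → Fin n) → Series N) → Series N
  sumOverFunctions {N} k n F = sum (seriesRawSemiring N) {n ℕ.^ k} λ i → F (finToFun i)

  -- If G = Σ gₘ x^m / m! then the ordinary coefficient of x^m is gₘ / m!,
  -- so gₘ = m₀! ⋯ mₖ! · [x^m] G.
  exponentialCoefficient : Series n → Vec ℕ n → Carrier
  exponentialCoefficient G m = _×_ rawSemiring (foldr′ ℕ._*_ 1 (map _! m)) (G m)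

  coefficientAt : ∀ {v ℓ′} → Series (suc k) → ColoredSet v ℓ′ k → Carrier
  coefficientAt G C = exponentialCoefficient G (ColoredSet.multiplicities C)

  infix 4 _≋_
  _≋_ : Series n → Series n → Set ℓ
  _≋_ {n} = RawSemiring._≈_ (seriesRawSemiring n)

  infixr 8 _^_
  _^_ : Series n → ℕ → Series n
  _^_ {n} = RawSemiringDefs._^_ (seriesRawSemiring n)

  fromℕ : ℕ → Carrier
  fromℕ N = _×_ rawSemiring N 1#

{-# OPTIONS --safe #-}
module Submission where

-- Identify ∏ₗ x_{c(l)} with the colouring c : [n] → {0,…,k} of its factors.
-- 𝒟 sends this monomial to the sum, over l ∈ [n], of the monomials in which
-- the l-th factor xⱼ is replaced by xⱼ₊₁.  Extending f : [k] → [n] by a new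
-- point with image l changes the colouring |f⁻¹(–)| in exactly this way, so
-- the expansion of Δₖ x₀ⁿ follows by induction on k.
--
-- For the coefficients, the bijections carrying one colouring to another
-- number m₀! ⋯ mₖ! if the two have the same colour multiplicities m, and 0
-- otherwise: fix the image of the first point and induct on n.  Summing over
-- f gives the exponential coefficient of ∑_f w(f) at m.

open import Algebra.Bundles using (CommutativeMonoid; CommutativeRing)
open import Algebra.Definitions.RawSemiring using (product)
import Algebra.Properties.CommutativeMonoid.Mult as CommutativeMonoidMult
import Algebra.Properties.CommutativeMonoid.Sum as CommutativeMonoidSum
import Algebra.Properties.Monoid.Mult as MonoidMult
import Algebra.Properties.Semiring.Sum as SemiringSum
open import Data.Bool.Base using (Bool; true; false; _∧_; if_then_else_)
open import Data.Empty using (⊥-elim)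
open import Data.Fin.Base using (Fin; zero; suc; toℕ; inject₁; punchIn; finToFun; funToFin; combine; _↑ˡ_; _↑ʳ_)
import Data.Fin.Properties as Fin
open import Data.Fin.Permutation as Perm using (Permutation; _⟨$⟩ʳ_)
open import Data.Fin.Subset using (∣_∣)
open import Data.Nat.Base using (ℕ; zero; suc; _!; _∸_; _≤_) renaming (_+_ to _+ℕ_; _*_ to _*ℕ_; _^_ to _^ℕ_)
import Data.Nat.Properties as ℕ
open import Data.Product.Base using (Σ; ∃-syntax; _×_; _,_; proj₁; proj₂)
open import Data.Sum.Base using (_⊎_; inj₁; inj₂)
open import Data.Sum.Function.Propositional using (_⊎-↔_)
open import Data.Vec.Base using (Vec; []; _∷_; _∷ʳ_; lookup; replicate; tabulate; map; foldr′; init; last; zipWith; _[_]≔_; _[_]%=_)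
import Data.Vec.Properties as Vec
open import Function.Base using (_∘_)
open import Function.Bundles using (Inverse; Bijection; _↔_; mk↔ₛ′; mk⇔)
import Function.Consequences.Setoid as SetoidConsequences
import Function.Construct.Composition as Composition
open import Function.Construct.Composition using (_↔-∘_)
open import Function.Construct.Identity using (↔-id)
open import Function.Construct.Symmetry using (↔-sym)
open import Function.Properties.Bijection using (⤖⇒↔)
open import Function.Properties.Inverse using (↔⇒⤖)
open import Level using (Level; 0ℓ; _⊔_)
open import Relation.Binary.Bundles using (Setoid)
import Relation.Binary.Construct.On as On
open import Relation.Binary.PropositionalEquality using (_≡_; _≢_; _≗_; refl; sym; trans; cong; cong₂; subst; isEquivalence; module ≡-Reasoning)
import Relation.Binary.Reasoning.Setoid as SetoidReasoning
open import Relation.Nullary.Decidable using (Dec; yes; no; does; dec-true; dec-false; does-⇔)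
open import Relation.Nullary.Negation using (¬_)

open import Defs

private
  variable
    a ℓ : Level
    k n s K : ℕ

-- Exponent vectors, and the contents of colourings.

infixl 6 _⊕_
_⊕_ : Vec ℕ K → Vec ℕ K → Vec ℕ K
_⊕_ = zipWith _+ℕ_

⊕-commutativeMonoid : ℕ → CommutativeMonoid 0ℓ 0ℓ
⊕-commutativeMonoid K = record
  { Carrier = Vec ℕ K
  ; _≈_ = _≡_
  ; _∙_ = _⊕_
  ; ε = replicate K 0
  ; isCommutativeMonoid = record
    { isMonoid = record
      { isSemigroup = record
        { isMagma = record { isEquivalence = isEquivalence ; ∙-cong = cong₂ _⊕_ }
        ; assoc = Vec.zipWith-assoc ℕ.+-assoc
        }
      ; identity = Vec.zipWith-identityˡ ℕ.+-identityˡ , Vec.zipWith-identityʳ ℕ.+-identityʳ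
      }
    ; comm = Vec.zipWith-comm ℕ.+-comm
    }
  }

private
  module ⊕-Sum {K} = CommutativeMonoidSum (⊕-commutativeMonoid K)
  module ℕ-Sum = CommutativeMonoidSum ℕ.+-0-commutativeMonoid

⊕-cancelˡ : (u a b : Vec ℕ K) → u ⊕ a ≡ u ⊕ b → a ≡ b
⊕-cancelˡ []      []      []      _  = refl
⊕-cancelˡ (x ∷ u) (y ∷ a) (z ∷ b) eq =
  cong₂ _∷_ (ℕ.+-cancelˡ-≡ x y z (Vec.∷-injectiveˡ eq)) (⊕-cancelˡ u a b (Vec.∷-injectiveʳ eq))

-- The exponent vector of a single variable: `x i` unfolds to `monomial (unit i)`.
unit : Fin K → Vec ℕ K
unit i = replicate _ 0 [ i ]≔ 1

unit-⊕ : (j : Fin K) (m : Vec ℕ K) → unit j ⊕ m ≡ m [ j ]%= suc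
unit-⊕ zero    (x ∷ m) = cong (suc x ∷_) (Vec.zipWith-identityˡ ℕ.+-identityˡ m)
unit-⊕ (suc j) (x ∷ m) = cong (x ∷_) (unit-⊕ j m)

lookup-unit : (i l : Fin K) → lookup (unit i) l ≡ (if does (i Fin.≟ l) then 1 else 0)
lookup-unit zero    zero    = refl
lookup-unit zero    (suc l) = Vec.lookup-replicate l 0
lookup-unit (suc i) zero    = refl
lookup-unit (suc i) (suc l) = lookup-unit i l

unit-inject₁ : (j : Fin K) → unit (inject₁ j) ≡ unit j ∷ʳ 0
unit-inject₁ {suc K} zero    = cong (1 ∷_) (replicate-∷ʳ K)
  where
  replicate-∷ʳ : ∀ K → replicate (suc K) 0 ≡ replicate K 0 ∷ʳ 0
  replicate-∷ʳ zero    = refl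
  replicate-∷ʳ (suc K) = cong (0 ∷_) (replicate-∷ʳ K)
unit-inject₁ (suc j) = cong (0 ∷_) (unit-inject₁ j)

-- The exponent vector of ∏ᵢ x_{c(i)}.
content : (Fin n → Fin K) → Vec ℕ K
content c = ⊕-Sum.sum (unit ∘ c)

content-cong : {c d : Fin n → Fin K} → c ≗ d → content c ≡ content d
content-cong c≗d = ⊕-Sum.sum-cong-≗ (cong unit ∘ c≗d)

content-remove : (c : Fin (suc n) → Fin K) (i : Fin (suc n)) →
                 content c ≡ unit (c i) ⊕ content (c ∘ punchIn i)
content-remove c i = ⊕-Sum.sum-remove {i = i} (unit ∘ c)

∷ʳ-⊕ : (a b : Vec ℕ K) → (a ⊕ b) ∷ʳ 0 ≡ (a ∷ʳ 0) ⊕ (b ∷ʳ 0)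
∷ʳ-⊕ []      []      = refl
∷ʳ-⊕ (x ∷ a) (y ∷ b) = cong (x +ℕ y ∷_) (∷ʳ-⊕ a b)

-- Embedding the colours into a palette with one more, last colour adds a zero exponent at the end,
-- which is also the effect of `include` on a monomial.
content-inject₁ : (c : Fin n → Fin K) → content (inject₁ ∘ c) ≡ content c ∷ʳ 0
content-inject₁ {zero}  {zero}  c = refl
content-inject₁ {zero}  {suc K} c = cong (0 ∷_) (content-inject₁ {zero} {K} λ ())
content-inject₁ {suc n} c = trans
  (cong₂ _⊕_ (unit-inject₁ (c zero)) (content-inject₁ (c ∘ suc)))
  (sym (∷ʳ-⊕ (unit (c zero)) (content (c ∘ suc))))

-- The test `c zero ≟ l` decides both whether the first point adds one to entry `l` and whether it
-- lies in the fibre, so the two sides obey the same recursion.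
lookup-content : (c : Fin n → Fin K) (l : Fin K) → lookup (content c) l ≡ ∣ fibre c l ∣
lookup-content {zero}  c l = Vec.lookup-replicate l 0
lookup-content {suc n} c l
  rewrite Vec.lookup-zipWith _+ℕ_ l (unit (c zero)) (content (c ∘ suc))
        | lookup-unit (c zero) l | lookup-content (c ∘ suc) l
  with does (c zero Fin.≟ l)
... | true  = refl
... | false = refl

tabulate-fibre : (c : Fin n → Fin K) → tabulate (λ i → ∣ fibre c i ∣) ≡ content c
tabulate-fibre c = trans (Vec.tabulate-cong (sym ∘ lookup-content c)) (Vec.tabulate∘lookup (content c))

-- The entry at the colour of the first point is a successor.
content-suc≢0 : (c : Fin (suc n) → Fin K) → content c ≢ replicate K 0
content-suc≢0 {K = K} c eq = ℕ.1+n≢0 (begin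
  suc (lookup rest (c zero))                  ≡⟨ Vec.lookup∘updateAt (c zero) rest ⟨
  lookup (rest [ c zero ]%= suc) (c zero)     ≡⟨ cong at-c₀ (unit-⊕ (c zero) rest) ⟨
  lookup (content c) (c zero)                 ≡⟨ cong at-c₀ eq ⟩
  lookup (replicate K 0) (c zero)             ≡⟨ Vec.lookup-replicate (c zero) 0 ⟩
  0                                           ∎)
  where
  open ≡-Reasoning
  rest = content (c ∘ suc)
  at-c₀ = λ m → lookup m (c zero)

-- Finite sums in a commutative monoid.

module _ {c ℓ} (M : CommutativeMonoid c ℓ) where
  open CommutativeMonoid M
    using (Carrier; _≈_; _∙_; ε; identityˡ; identityʳ; ∙-congˡ; assoc)
    renaming (refl to ≈-refl; sym to ≈-sym; trans to ≈-trans)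
  open CommutativeMonoidSum M using (sum; sum-replicate-zero)
  open MonoidMult (CommutativeMonoid.monoid M) renaming (_×_ to _·_)

  -- Used over ℕ to count the admissible images of a first point, and over series to turn the
  -- exponent produced by `∂ j` into a sum over the factors of colour `j`.
  sum-indicator : (c : Fin n → Fin K) (j : Fin K) (x : Carrier) →
                  sum (λ i → if does (c i Fin.≟ j) then x else ε) ≈ lookup (content c) j · x
  sum-indicator c j x rewrite lookup-content c j = go c
    where
    go : (c : Fin n → Fin _) → sum (λ i → if does (c i Fin.≟ j) then x else ε) ≈ ∣ fibre c j ∣ · x
    go {zero}  c = ≈-refl
    go {suc n} c with does (c zero Fin.≟ j)
    ... | true  = ∙-congˡ (go (c ∘ suc))
    ... | false = ≈-trans (identityˡ _) (go (c ∘ suc))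

  sum-δ : (i : Fin n) (x : Carrier) → sum (λ j → if does (i Fin.≟ j) then x else ε) ≈ x
  sum-δ {suc n} zero    x = ≈-trans (∙-congˡ (sum-replicate-zero n)) (identityʳ x)
  sum-δ {suc n} (suc i) x = ≈-trans (identityˡ _) (sum-δ i x)

  sum-++ : ∀ m {n} (t : Fin (m +ℕ n) → Carrier) →
           sum t ≈ sum (λ i → t (i ↑ˡ n)) ∙ sum (λ j → t (m ↑ʳ j))
  sum-++ zero    t = ≈-sym (identityˡ _)
  sum-++ (suc m) t = ≈-trans (∙-congˡ (sum-++ m (t ∘ suc))) (≈-sym (assoc _ _ _))

  -- Separates a sum over coded functions into a sum over the value at the first point and a sum
  -- over the rest.
  sum-combine : ∀ m n (t : Fin (m *ℕ n) → Carrier) →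
                sum t ≈ sum {m} (λ i → sum {n} λ j → t (combine i j))
  sum-combine zero    n t = ≈-refl
  sum-combine (suc m) n t = ≈-trans (sum-++ n t) (∙-congˡ (sum-combine m n (λ i → t (n ↑ʳ i))))

-- Products of factorials of exponents.

_≟ᵛ_ : (a b : Vec ℕ K) → Dec (a ≡ b)
_≟ᵛ_ = Vec.≡-dec ℕ._≟_

factorials : Vec ℕ K → ℕ
factorials m = foldr′ _*ℕ_ 1 (map _! m)

-- Only the `j`-th factorial changes, by (x+1)! = (x+1) x!.
factorials-unit-⊕ : (j : Fin K) (m : Vec ℕ K) →
                    factorials (unit j ⊕ m) ≡ lookup (unit j ⊕ m) j *ℕ factorials m
factorials-unit-⊕ j m rewrite unit-⊕ j m = go j m
  where
  go : ∀ {K} (j : Fin K) m → factorials (m [ j ]%= suc) ≡ lookup (m [ j ]%= suc) j *ℕ factorials m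
  go zero    (x ∷ m) = ℕ.*-assoc (suc x) (x !) (factorials m)
  go (suc j) (x ∷ m) = begin
    x ! *ℕ factorials (m [ j ]%= suc)  ≡⟨ cong (x ! *ℕ_) (go j m) ⟩
    x ! *ℕ (l *ℕ factorials m)         ≡⟨ ℕ.*-assoc (x !) l _ ⟨
    x ! *ℕ l *ℕ factorials m           ≡⟨ cong (_*ℕ factorials m) (ℕ.*-comm (x !) l) ⟩
    l *ℕ x ! *ℕ factorials m           ≡⟨ ℕ.*-assoc l (x !) _ ⟩
    l *ℕ (x ! *ℕ factorials m)         ∎
    where
    open ≡-Reasoning
    l = lookup (m [ j ]%= suc) j

factorials-replicate-0 : ∀ K → factorials (replicate K 0) ≡ 1
factorials-replicate-0 zero    = refl
factorials-replicate-0 (suc K) = trans (ℕ.+-identityʳ _) (factorials-replicate-0 K)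

-- Cardinalities of setoids

strictInverse : ∀ {a b ℓ₁ ℓ₂} {S : Setoid a ℓ₁} {T : Setoid b ℓ₂} →
  let module S = Setoid S; module T = Setoid T in
  (to : S.Carrier → T.Carrier) (from : T.Carrier → S.Carrier) →
  (∀ {x y} → x S.≈ y → to x T.≈ to y) → (∀ {x y} → x T.≈ y → from x S.≈ from y) →
  (∀ y → to (from y) T.≈ y) → (∀ x → from (to x) S.≈ x) → Inverse S T
strictInverse {S = S} {T = T} to from to-cong from-cong to∘from from∘to = record
  { to = to ; from = from ; to-cong = to-cong ; from-cong = from-cong
  ; inverse = strictlyInverseˡ⇒inverseˡ to-cong to∘from
            , strictlyInverseʳ⇒inverseʳ {f = to} from-cong from∘to
  }
  where open SetoidConsequences S T

empty-hasCardinality : {S : Setoid a ℓ} → ¬ Setoid.Carrier S → HasCardinality S 0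
empty-hasCardinality {S = S} ¬S =
  strictInverse {T = S} (λ ()) (⊥-elim ∘ ¬S) (λ { {()} }) (λ {x} → ⊥-elim (¬S x)) (⊥-elim ∘ ¬S) (λ ())

sum-↔ : (c : Fin n → ℕ) → Fin (ℕ-Sum.sum c) ↔ Σ (Fin n) (Fin ∘ c)
sum-↔ {zero}  c = mk↔ₛ′ (λ ()) (λ ()) (λ ()) (λ ())
sum-↔ {suc n} c = split ↔-∘ ((↔-id _ ⊎-↔ sum-↔ (c ∘ suc)) ↔-∘ Fin.+↔⊎)
  where
  split : (Fin (c zero) ⊎ Σ (Fin n) (Fin ∘ c ∘ suc)) ↔ Σ (Fin (suc n)) (Fin ∘ c)
  split = mk↔ₛ′
    (λ { (inj₁ j) → zero , j ; (inj₂ (i , j)) → suc i , j })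
    (λ { (zero , j) → inj₁ j ; (suc i , j) → inj₂ (i , j) })
    (λ { (zero , j) → refl ; (suc i , j) → refl })
    (λ { (inj₁ j) → refl ; (inj₂ (i , j)) → refl })

module _ (S : Setoid a ℓ) (p : Setoid.Carrier S → Fin n) where
  private module S = Setoid S

  -- Equality is inherited from `S`, so the proofs of `p s ≡ i` are not compared.
  fibreSetoid : Fin n → Setoid a ℓ
  fibreSetoid i = On.setoid {B = Σ S.Carrier λ s → p s ≡ i} S proj₁

  -- `S` is the disjoint union of the fibres of `p`; since `p` respects equality, equal elements
  -- share a fibre, and an element is coded by its fibre and its position there.
  sum-hasCardinality : (∀ {s t} → s S.≈ t → p s ≡ p t) → (c : Fin n → ℕ) →
    (∀ i → HasCardinality (fibreSetoid i) (c i)) → HasCardinality S (ℕ-Sum.sum c)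
  sum-hasCardinality p-cong c card = strictInverse {T = S}
    (toS ∘ Σ↔.to) (λ s → Σ↔.from (fromS s))
    (λ { refl → S.refl }) (cong Σ↔.from ∘ fromS-cong)
    (λ s → S.trans (S.reflexive (cong toS (Σ↔.strictlyInverseˡ (fromS s))))
                   (F.strictlyInverseˡ (p s) (s , refl)))
    (λ x → trans (cong Σ↔.from (fromS-toS (Σ↔.to x))) (Σ↔.strictlyInverseʳ x))
    where
    module Σ↔ = Inverse (sum-↔ c)
    module F i = Inverse (card i)

    toS : Σ (Fin n) (Fin ∘ c) → S.Carrier
    toS (i , j) = proj₁ (F.to i j)

    fromS : S.Carrier → Σ (Fin n) (Fin ∘ c)
    fromS s = p s , F.from (p s) (s , refl)

    -- Matching on `e` moves the index from `p s` to `i`, so that codes over two equal indices can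
    -- be compared without an explicit transport.
    fromS-≡ : ∀ s {i} (e : p s ≡ i) → fromS s ≡ (i , F.from i (s , e))
    fromS-≡ s refl = refl

    fromS-cong : ∀ {s t} → s S.≈ t → fromS s ≡ fromS t
    fromS-cong {s} {t} s≈t = trans (fromS-≡ s (p-cong s≈t)) (cong (p t ,_) (F.from-cong (p t) s≈t))

    fromS-toS : ∀ x → fromS (toS x) ≡ x
    fromS-toS (i , j) = trans (fromS-≡ (toS (i , j)) (proj₂ (F.to i j)))
                              (cong (i ,_) (F.strictlyInverseʳ i j))

-- Colour-preserving bijections

ColourPreserving : (Fin n → Fin K) → (Fin s → Fin K) → Setoid 0ℓ 0ℓ
ColourPreserving {n = n} {s = s} g κ = record
  { Carrier = Σ (Permutation n s) λ π → ∀ j → κ (π ⟨$⟩ʳ j) ≡ g j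
  ; _≈_ = λ π ρ → proj₁ π Perm.≈ proj₁ ρ
  ; isEquivalence = record
    { refl = λ _ → refl
    ; sym = λ e i → sym (e i)
    ; trans = λ d e i → trans (d i) (e i)
    }
  }

module _ (g : Fin (suc n) → Fin K) (κ : Fin (suc s) → Fin K) (v : Fin (suc s)) (κv≡g₀ : κ v ≡ g zero) where
  private
    Fibre = fibreSetoid (ColourPreserving g κ) (λ π → proj₁ π ⟨$⟩ʳ zero) v
    Rest  = ColourPreserving (g ∘ suc) (κ ∘ punchIn v)
    module Fibre = Setoid Fibre
    module Rest = Setoid Rest

  insert-zero : Rest.Carrier → Fibre.Carrier
  insert-zero (π , π-ok) = (Perm.insert zero v π , λ { zero → κv≡g₀ ; (suc j) → π-ok j }) , refl

  remove-zero : Fibre.Carrier → Rest.Carrier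
  remove-zero ((π , π-ok) , refl) =
    Perm.remove zero π , λ j → trans (cong κ (sym (Perm.punchIn-permute π zero j))) (π-ok (suc j))

  punchIn-remove-zero : ∀ π j → punchIn v (proj₁ (remove-zero π) ⟨$⟩ʳ j) ≡ proj₁ (proj₁ π) ⟨$⟩ʳ suc j
  punchIn-remove-zero ((π , _) , refl) j = sym (Perm.punchIn-permute π zero j)

  -- A bijection sending `zero` to `v` amounts to a bijection between the remaining points, with
  -- `punchIn v` naming those other than `v`; the colour condition at `zero` is `κv≡g₀`.
  ColourPreserving-remove : Inverse Rest Fibre
  ColourPreserving-remove = strictInverse {S = Rest} {T = Fibre} insert-zero remove-zero
    (λ { π≈ρ zero → refl ; π≈ρ (suc j) → cong (punchIn v) (π≈ρ j) })
    (λ {π} {ρ} π≈ρ j → Fin.punchIn-injective v _ _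
      (trans (punchIn-remove-zero π j) (trans (π≈ρ (suc j)) (sym (punchIn-remove-zero ρ j)))))
    (λ { ((π , _) , refl) → Perm.insert-remove zero π })
    (λ { (π , _) → Perm.remove-insert zero v π })

-- The domains may differ in size: both contents still lie in `Vec ℕ K`, and different sizes force
-- different contents, hence the value 0.
colourPreservingCount : (Fin n → Fin K) → (Fin s → Fin K) → ℕ
colourPreservingCount g κ =
  if does (content κ ≟ᵛ content g) then factorials (content κ) else 0

colourPreservingCount-≢ : (g : Fin n → Fin K) (κ : Fin s → Fin K) → content κ ≢ content g →
                          colourPreservingCount g κ ≡ 0
colourPreservingCount-≢ g κ κ≢g rewrite dec-false (content κ ≟ᵛ content g) κ≢g = refl

×-≡-* : ∀ m n → MonoidMult._×_ ℕ.+-0-monoid m n ≡ m *ℕ n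
×-≡-* zero    n = refl
×-≡-* (suc m) n = cong (n +ℕ_) (×-≡-* m n)

module _ (g : Fin (suc n) → Fin K) (κ : Fin (suc s) → Fin K) where

  firstImageCount : Fin (suc s) → ℕ
  firstImageCount v =
    if does (κ v Fin.≟ g zero) then colourPreservingCount (g ∘ suc) (κ ∘ punchIn v) else 0

  -- Each `v` of colour `g zero` contributes the same number `r`, and the content of `κ` tells how
  -- many such `v` there are; multiplying `r` by that exponent restores the missing factor of the
  -- factorial.
  sum-firstImageCount : ℕ-Sum.sum firstImageCount ≡ colourPreservingCount g κ
  sum-firstImageCount = begin
    ℕ-Sum.sum firstImageCount
      ≡⟨ ℕ-Sum.sum-cong-≗ step ⟩
    ℕ-Sum.sum (λ v → if does (κ v Fin.≟ g zero) then r else 0)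
      ≡⟨ sum-indicator ℕ.+-0-commutativeMonoid κ (g zero) r ⟩
    MonoidMult._×_ ℕ.+-0-monoid (lookup (content κ) (g zero)) r
      ≡⟨ ×-≡-* (lookup (content κ) (g zero)) r ⟩
    lookup (content κ) (g zero) *ℕ r
      ≡⟨ total ⟩
    colourPreservingCount g κ ∎
    where
    open ≡-Reasoning

    g⁻ = content (g ∘ suc)

    -- Deleting `v` and `zero` takes the same unit vector off both contents, so testing the full
    -- contents is equivalent to testing the remainders, and the test no longer mentions `v`.
    r : ℕ
    r = if does (content κ ≟ᵛ content g) then factorials g⁻ else 0

    step : ∀ v → firstImageCount v ≡ (if does (κ v Fin.≟ g zero) then r else 0)
    step v with κ v Fin.≟ g zero
    ... | no _ = refl
    ... | yes κv≡g₀ = go (content (κ ∘ punchIn v) ≟ᵛ g⁻)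
      where
      κ-split : content κ ≡ unit (g zero) ⊕ content (κ ∘ punchIn v)
      κ-split = trans (content-remove κ v) (cong (λ u → unit u ⊕ content (κ ∘ punchIn v)) κv≡g₀)

      go : (e? : Dec (content (κ ∘ punchIn v) ≡ g⁻)) →
           (if does e? then factorials (content (κ ∘ punchIn v)) else 0) ≡ r
      go (yes e) rewrite dec-true (content κ ≟ᵛ content g) (trans κ-split (cong (unit (g zero) ⊕_) e)) =
        cong factorials e
      go (no ¬e) rewrite dec-false (content κ ≟ᵛ content g)
        (λ e → ¬e (⊕-cancelˡ (unit (g zero)) _ _ (trans (sym κ-split) e))) = refl

    total : lookup (content κ) (g zero) *ℕ r ≡ colourPreservingCount g κ
    total with content κ ≟ᵛ content g
    ... | yes e rewrite e = sym (factorials-unit-⊕ (g zero) g⁻)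
    ... | no _ = ℕ.*-zeroʳ (lookup (content κ) (g zero))

-- Induction on the source, sorting bijections by the image of `zero`. If exactly one side is empty
-- there are no bijections, and exactly one content vanishes, so the formula gives 0.
ColourPreserving-hasCardinality : (g : Fin n → Fin K) (κ : Fin s → Fin K) →
  HasCardinality (ColourPreserving g κ) (colourPreservingCount g κ)
ColourPreserving-hasCardinality {zero} {K} {zero} g κ =
  subst (HasCardinality (ColourPreserving g κ)) (sym count≡1)
    (strictInverse {T = ColourPreserving g κ}
      (λ _ → Perm.id , λ ()) (λ _ → zero) (λ _ ()) (λ _ → refl) (λ _ ()) (λ { zero → refl }))
  where
  count≡1 : colourPreservingCount g κ ≡ 1
  count≡1 rewrite dec-true (content κ ≟ᵛ content g) refl = factorials-replicate-0 K
ColourPreserving-hasCardinality {zero} {K} {suc s} g κ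
  rewrite colourPreservingCount-≢ g κ (content-suc≢0 κ) =
  empty-hasCardinality (Perm.refute (λ ()) ∘ proj₁)
ColourPreserving-hasCardinality {suc n} {K} {zero} g κ
  rewrite colourPreservingCount-≢ g κ (content-suc≢0 g ∘ sym) =
  empty-hasCardinality (Perm.refute (λ ()) ∘ proj₁)
ColourPreserving-hasCardinality {suc n} {K} {suc s} g κ =
  subst (HasCardinality (ColourPreserving g κ)) (sum-firstImageCount g κ)
    (sum-hasCardinality (ColourPreserving g κ) (λ π → proj₁ π ⟨$⟩ʳ zero) (λ π≈ρ → π≈ρ zero)
      (firstImageCount g κ) firstImage)
  where
  firstImage : ∀ v → HasCardinality (fibreSetoid (ColourPreserving g κ) (λ π → proj₁ π ⟨$⟩ʳ zero) v)
                                    (firstImageCount g κ v)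
  firstImage v with κ v Fin.≟ g zero
  ... | yes κv≡g₀ = Composition.inverse
    (ColourPreserving-hasCardinality (g ∘ suc) (κ ∘ punchIn v)) (ColourPreserving-remove g κ v κv≡g₀)
  ... | no κv≢g₀ = empty-hasCardinality λ { ((π , π-ok) , refl) → κv≢g₀ (π-ok zero) }

-- Counting compatible pairs.

fibre-cong : {f g : Fin k → Fin n} → f ≗ g → ∀ j → fibre f j ≡ fibre g j
fibre-cong f≗g j = Vec.tabulate-cong λ i → cong (λ y → does (y Fin.≟ j)) (f≗g i)

toℕ-fibreSize : (f : Fin k → Fin n) (i : Fin n) → toℕ (fibreSize f i) ≡ ∣ fibre f i ∣
toℕ-fibreSize f i = Fin.toℕ-fromℕ< _

funToFin-cong : {f g : Fin k → Fin n} → f ≗ g → funToFin f ≡ funToFin g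
funToFin-cong {zero}  f≗g = refl
funToFin-cong {suc k} f≗g = cong₂ combine (f≗g zero) (funToFin-cong (f≗g ∘ suc))

module _ {v ℓ} (n : ℕ) (C : ColoredSet v ℓ k) where
  open ColoredSet C using (κ; enum)
  open CompatiblePair
  private
    module E = Inverse enum
    Pairs = compatiblePairs n C
    code : CompatiblePair n C → Fin (n ^ℕ k)
    code = funToFin ∘ f
    decode : Fin (n ^ℕ k) → Fin k → Fin n
    decode = finToFun

  -- Once the code of `f` is fixed, only `h` is left to choose. Transport along `enum` makes it a
  -- bijection onto `Fin size`, and compatibility becomes preservation of the colouring by fibre
  -- sizes.
  compatiblePairsOver : ∀ i → Inverse (ColourPreserving (fibreSize (decode i)) (κ ∘ E.to))
                                      (fibreSetoid Pairs code i)
  compatiblePairsOver i = strictInverse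
    {S = ColourPreserving (fibreSize (decode i)) (κ ∘ E.to)} {T = fibreSetoid Pairs code i}
    (λ { (π , π-ok) → record
      { f = decode i
      ; h = ↔⇒⤖ (enum ↔-∘ π)
      ; compatible = λ j → trans (cong toℕ (π-ok j)) (toℕ-fibreSize (decode i) j)
      } , Fin.funToFin-finToFin {k} i })
    (λ { (q , q≡i) → ↔-sym enum ↔-∘ ⤖⇒↔ (h q) , λ j → Fin.toℕ-injective (begin
      toℕ (κ (E.to (E.from (Bijection.to (h q) j))))  ≡⟨ cong (toℕ ∘ κ) (E.strictlyInverseˡ _) ⟩
      toℕ (κ (Bijection.to (h q) j))                  ≡⟨ compatible q j ⟩
      ∣ fibre (f q) j ∣                               ≡⟨ cong ∣_∣ (fibre-cong (f≗ q q≡i) j) ⟩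
      ∣ fibre (decode i) j ∣                        ≡⟨ toℕ-fibreSize (decode i) j ⟨
      toℕ (fibreSize (decode i) j)                  ∎) })
    (λ π≈ρ → (λ _ → refl) , (λ j → cong E.to (π≈ρ j)))
    (λ q≈r j → cong E.from (proj₂ q≈r j))
    -- The round trip replaces `f q` by `decode i`, which agrees with it pointwise; the equality of
    -- pairs asks for no more.
    (λ { (q , q≡i) → (sym ∘ f≗ q q≡i) , (λ j → E.strictlyInverseˡ _) })
    (λ _ j → E.strictlyInverseʳ _)
    where
    open ≡-Reasoning
    f≗ : ∀ q → code q ≡ i → f q ≗ decode i
    f≗ q refl j = sym (Fin.finToFun-funToFin (f q) j)

  compatiblePairs-hasCardinality : HasCardinality Pairs
    (ℕ-Sum.sum {n ^ℕ k} λ i → colourPreservingCount (fibreSize (decode i)) (κ ∘ E.to))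
  compatiblePairs-hasCardinality = sum-hasCardinality Pairs code (funToFin-cong ∘ proj₁) _ λ i →
    Composition.inverse
      (ColourPreserving-hasCardinality (fibreSize (decode i)) (κ ∘ E.to)) (compatiblePairsOver i)

-- The change of colouring under one application of `𝒟`.

-- 𝒟 acting on the i-th factor of ∏ₗ x_{c(l)}, which it turns from xⱼ into xⱼ₊₁.
bump : (Fin n → Fin K) → Fin n → Fin n → Fin (suc K)
bump c i l = if does (i Fin.≟ l) then suc (c l) else inject₁ (c l)

-- With the factor `i` split off, the right side is the exponent of `x (suc (c i))` times the
-- included product of the other factors, the form in which `𝒟` delivers it.
content-bump : (c : Fin (suc n) → Fin K) (i : Fin (suc n)) →
               content (bump c i) ≡ unit (suc (c i)) ⊕ (content (c ∘ punchIn i) ∷ʳ 0)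
content-bump c i = trans (content-remove (bump c i) i)
  (cong₂ _⊕_ (cong unit at-i) (trans (content-cong away) (content-inject₁ (c ∘ punchIn i))))
  where
  at-i : bump c i i ≡ suc (c i)
  at-i rewrite dec-true (i Fin.≟ i) refl = refl

  away : bump c i ∘ punchIn i ≗ inject₁ ∘ c ∘ punchIn i
  away l rewrite dec-false (i Fin.≟ punchIn i l) (Fin.punchInᵢ≢i i l ∘ sym) = refl

-- `combine i f` codes the function with value `i` at the new point `zero` and `f` elsewhere, so
-- only the fibre over `i` grows. The other sizes are merely re-indexed by `inject₁`.
fibreSize-combine : (i : Fin n) (f : Fin (n ^ℕ k)) →
  fibreSize (finToFun {n} {suc k} (combine i f)) ≗ bump (fibreSize (finToFun {n} {k} f)) i
fibreSize-combine {n} {k} i f l = Fin.toℕ-injective (begin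
  toℕ (fibreSize g l)                       ≡⟨ toℕ-fibreSize g l ⟩
  ∣ fibre g l ∣                             ≡⟨ cong (λ p → ∣ fibre (cons p) l ∣) (Fin.remQuot-combine i f) ⟩
  ∣ fibre (cons (i , f)) l ∣                ≡⟨ cons-fibre ⟩
  toℕ (bump (fibreSize (finToFun f)) i l)   ∎)
  where
  open ≡-Reasoning
  g = finToFun {n} {suc k} (combine i f)

  cons : Fin n × Fin (n ^ℕ k) → Fin (suc k) → Fin n
  cons (i , f) zero    = i
  cons (i , f) (suc j) = finToFun f j

  cons-fibre : ∣ fibre (cons (i , f)) l ∣ ≡ toℕ (bump (fibreSize (finToFun {n} {k} f)) i l)
  cons-fibre with does (i Fin.≟ l)
  ... | true  = cong suc (sym (toℕ-fibreSize (finToFun f) l))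
  ... | false = sym (trans (Fin.toℕ-inject₁ _) (toℕ-fibreSize (finToFun f) l))

-- The expansion of Δₖ x₀ⁿ

module _ {c ℓ} (R : CommutativeRing c ℓ) where
  open CommutativeRing R
    using ( Carrier; _≈_; _+_; _*_; 0#; 1#; setoid; reflexive; semiring; +-monoid; +-commutativeMonoid
          ; +-cong; +-assoc; +-comm; +-identityˡ; +-identityʳ
          ; *-cong; *-identityˡ; zeroˡ; zeroʳ; distribˡ)
    renaming (refl to ≈-refl; sym to ≈-sym; trans to ≈-trans)
  open PowerSeries R
  private
    module Σᴿ = CommutativeMonoidSum +-commutativeMonoid
  open MonoidMult +-monoid using (×-congʳ; ×-homo-+) renaming (_×_ to _·_)
  open CommutativeMonoidMult +-commutativeMonoid using () renaming (×-distrib-+ to ·-distrib-+)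

  -- Natural multiples, and the additive monoid of series.

  ·-zero : ∀ m → m · 0# ≈ 0#
  ·-zero m = ≈-trans (≈-sym (Σᴿ.sum-replicate m)) (Σᴿ.sum-replicate-zero m)

  ·-distrib-sum : ∀ m (t : Fin n → Carrier) → m · Σᴿ.sum t ≈ Σᴿ.sum (λ i → m · t i)
  ·-distrib-sum {zero}  m t = ·-zero m
  ·-distrib-sum {suc n} m t =
    ≈-trans (·-distrib-+ _ _ m) (+-cong ≈-refl (·-distrib-sum m (t ∘ suc)))

  fromℕ-sum : (t : Fin n → ℕ) → fromℕ (ℕ-Sum.sum t) ≈ Σᴿ.sum (fromℕ ∘ t)
  fromℕ-sum {zero}  t = ≈-refl
  fromℕ-sum {suc n} t = ≈-trans (×-homo-+ 1# (t zero) _) (+-cong ≈-refl (fromℕ-sum (t ∘ suc)))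

  ⟦_⟧ : Bool → Carrier
  ⟦ b ⟧ = if b then 1# else 0#

  +-series-commutativeMonoid : ℕ → CommutativeMonoid c ℓ
  +-series-commutativeMonoid K = record
    { Carrier = Series K
    ; _≈_ = _≋_
    ; _∙_ = λ F G m → F m + G m
    ; ε = λ _ → 0#
    ; isCommutativeMonoid = record
      { isMonoid = record
        { isSemigroup = record
          { isMagma = record
            { isEquivalence = record
              { refl = λ _ → ≈-refl
              ; sym = λ e m → ≈-sym (e m)
              ; trans = λ d e m → ≈-trans (d m) (e m)
              }
            ; ∙-cong = λ d e m → +-cong (d m) (e m)
            }
          ; assoc = λ F G H m → +-assoc (F m) (G m) (H m)
          }
        ; identity = (λ F m → +-identityˡ (F m)) , (λ F m → +-identityʳ (F m))
        }
      ; comm = λ F G m → +-comm (F m) (G m)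
      }
    }

  private
    module +ˢ {K} = CommutativeMonoid (+-series-commutativeMonoid K)
    module Σˢ {K} = CommutativeMonoidSum (+-series-commutativeMonoid K)
    module ·ˢ {K} = MonoidMult (CommutativeMonoid.monoid (+-series-commutativeMonoid K))
    module ≋-Reasoning {K} = SetoidReasoning (+ˢ.setoid {K})

  sum-apply : (F : Fin n → Series K) (m : Vec ℕ K) → Σˢ.sum F m ≡ Σᴿ.sum λ i → F i m
  sum-apply {zero}  F m = refl
  sum-apply {suc n} F m = cong (F zero m +_) (sum-apply (F ∘ suc) m)

  ·-apply : ∀ n (F : Series K) (m : Vec ℕ K) → (n ·ˢ.× F) m ≡ n · F m
  ·-apply zero    F m = refl
  ·-apply (suc n) F m = cong (F m +_) (·-apply n F m)

  -- Convolution and products of monomials.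

  convolve-cong : {A B : Vec ℕ K → Vec ℕ K → Carrier} → (∀ a b → A a b ≈ B a b) → convolve A ≋ convolve B
  convolve-cong A≈B []      = A≈B [] []
  convolve-cong A≈B (d ∷ m) = Σᴿ.sum-cong-≋ {suc d} λ i →
    convolve-cong (λ a b → A≈B (toℕ i ∷ a) ((d ∸ toℕ i) ∷ b)) m

  convolve-zero : {A : Vec ℕ K → Vec ℕ K → Carrier} → (∀ a b → A a b ≈ 0#) → ∀ m → convolve A m ≈ 0#
  convolve-zero A≈0 []      = A≈0 [] []
  convolve-zero A≈0 (d ∷ m) = ≈-trans
    (Σᴿ.sum-cong-≋ {suc d} λ i → convolve-zero (λ a b → A≈0 (toℕ i ∷ a) ((d ∸ toℕ i) ∷ b)) m)
    (Σᴿ.sum-replicate-zero (suc d))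

  convolve-+ : (A B : Vec ℕ K → Vec ℕ K → Carrier) →
               ∀ m → convolve (λ a b → A a b + B a b) m ≈ convolve A m + convolve B m
  convolve-+ A B []      = ≈-refl
  convolve-+ A B (d ∷ m) = ≈-trans
    (Σᴿ.sum-cong-≋ {suc d} λ i → convolve-+ (at A i) (at B i) m)
    (Σᴿ.∑-distrib-+ (λ i → convolve (at A i) m) (λ i → convolve (at B i) m))
    where
    at : (Vec ℕ (suc _) → Vec ℕ (suc _) → Carrier) → Fin (suc d) → Vec ℕ _ → Vec ℕ _ → Carrier
    at K i a b = K (toℕ i ∷ a) ((d ∸ toℕ i) ∷ b)

  infixl 7 _·ᶜ_
  _·ᶜ_ : Series K → Series K → Series K
  F ·ᶜ G = convolve λ a b → F a * G b

  ·ᶜ-cong : {F F′ G G′ : Series K} → F ≋ F′ → G ≋ G′ → F ·ᶜ G ≋ F′ ·ᶜ G′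
  ·ᶜ-cong F≋ G≋ = convolve-cong λ a b → *-cong (F≋ a) (G≋ b)

  -- At most one `i` in {0,...,d} equals `p`, and the second test then holds exactly when d = p + q.
  -- This is the product of two monomials in one variable.
  sum-splittings : ∀ d p q →
    Σᴿ.sum {suc d} (λ i → ⟦ does (toℕ i ℕ.≟ p) ∧ does ((d ∸ toℕ i) ℕ.≟ q) ⟧) ≈ ⟦ does (d ℕ.≟ p +ℕ q) ⟧
  sum-splittings d       zero    q = ≈-trans (+-cong ≈-refl (Σᴿ.sum-replicate-zero d)) (+-identityʳ _)
  sum-splittings zero    (suc p) q = +-identityˡ 0#
  sum-splittings (suc d) (suc p) q = ≈-trans (+-identityˡ _) (sum-splittings d p q)

  monomial-· : (a b : Vec ℕ K) → monomial a ·ᶜ monomial b ≋ monomial (a ⊕ b)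
  monomial-· []      []      []      = *-identityˡ 1#
  monomial-· (p ∷ a) (q ∷ b) (d ∷ m) = begin
    Σᴿ.sum {suc d} (λ i → convolve (λ a′ b′ →
      ⟦ does (toℕ i ℕ.≟ p) ∧ does (a′ ≟ᵛ a) ⟧ * ⟦ does ((d ∸ toℕ i) ℕ.≟ q) ∧ does (b′ ≟ᵛ b) ⟧) m)
      -- Equality of vectors is tested as a conjunction over head and tail. The head tests are
      -- constant in the inner convolution, which is the product in the remaining variables.
      ≈⟨ Σᴿ.sum-cong-≋ {suc d} (λ i → inner (does (toℕ i ℕ.≟ p)) (does ((d ∸ toℕ i) ℕ.≟ q))) ⟩
    Σᴿ.sum {suc d} (λ i → ⟦ does (toℕ i ℕ.≟ p) ∧ does ((d ∸ toℕ i) ℕ.≟ q) ⟧ * y)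
      ≈⟨ SemiringSum.*-distribʳ-sum semiring y
           (λ (i : Fin (suc d)) → ⟦ does (toℕ i ℕ.≟ p) ∧ does ((d ∸ toℕ i) ℕ.≟ q) ⟧) ⟨
    Σᴿ.sum {suc d} (λ i → ⟦ does (toℕ i ℕ.≟ p) ∧ does ((d ∸ toℕ i) ℕ.≟ q) ⟧) * y
      ≈⟨ *-cong (sum-splittings d p q) ≈-refl ⟩
    ⟦ does (d ℕ.≟ p +ℕ q) ⟧ * y
      ≈⟨ ⟦⟧-* (does (d ℕ.≟ p +ℕ q)) ⟩
    ⟦ does (d ℕ.≟ p +ℕ q) ∧ does (m ≟ᵛ (a ⊕ b)) ⟧ ∎
    where
    open SetoidReasoning setoid
    y = monomial (a ⊕ b) m

    ⟦⟧-* : ∀ u → ⟦ u ⟧ * y ≈ ⟦ u ∧ does (m ≟ᵛ (a ⊕ b)) ⟧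
    ⟦⟧-* true  = *-identityˡ y
    ⟦⟧-* false = zeroˡ y

    inner : ∀ u v → convolve (λ a′ b′ → ⟦ u ∧ does (a′ ≟ᵛ a) ⟧ * ⟦ v ∧ does (b′ ≟ᵛ b) ⟧) m ≈ ⟦ u ∧ v ⟧ * y
    inner true  true  = ≈-trans (monomial-· a b m) (≈-sym (*-identityˡ y))
    inner true  false = ≈-trans (convolve-zero (λ _ _ → zeroʳ _) m) (≈-sym (zeroˡ y))
    inner false v     = ≈-trans (convolve-zero (λ _ _ → zeroˡ _) m) (≈-sym (zeroˡ y))

  product-x : (c : Fin n → Fin K) → product (seriesRawSemiring K) (x ∘ c) ≋ monomial (content c)
  product-x {zero}  c = λ _ → ≈-refl
  product-x {suc n} c = +ˢ.trans (·ᶜ-cong (λ _ → ≈-refl) (product-x (c ∘ suc)))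
                                 (monomial-· (unit (c zero)) (content (c ∘ suc)))

  x-^ : (i : Fin K) (n : ℕ) → x i ^ n ≋ monomial (content {n} λ _ → i)
  x-^ i zero    = λ _ → ≈-refl
  x-^ i (suc n) = +ˢ.trans (·ᶜ-cong (λ _ → ≈-refl) (x-^ i n))
                           (monomial-· (unit i) (content {n} λ _ → i))

  -- Inclusion and derivatives of monomials.

  include-monomial : (e : Vec ℕ K) → include (monomial e) ≋ monomial (e ∷ʳ 0)
  include-monomial []      (y ∷ []) with does (y ℕ.≟ 0)
  ... | true  = ≈-refl
  ... | false = ≈-refl
  include-monomial (p ∷ e) (y ∷ m) with does (y ℕ.≟ p)
  ... | true  = include-monomial e m
  ... | false with does (last m ℕ.≟ 0)
  ...   | true  = ≈-refl
  ...   | false = ≈-refl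

  -- `∂ j` without its numerical factor: it divides a monomial by `x j`, or kills it when `x j` does
  -- not occur.
  shift : Fin K → Series K → Series K
  shift j F m = F (m [ j ]%= suc)

  shift-monomial : (j : Fin K) (e : Vec ℕ K) → shift j (monomial (unit j ⊕ e)) ≋ monomial e
  shift-monomial j e m = reflexive (cong ⟦_⟧ (does-⇔
    (mk⇔ (λ eq → ⊕-cancelˡ (unit j) m e (trans (unit-⊕ j m) eq))
         (λ eq → trans (sym (unit-⊕ j m)) (cong (unit j ⊕_) eq)))
    ((m [ j ]%= suc) ≟ᵛ (unit j ⊕ e)) (m ≟ᵛ e)))

  -- The factor in `∂` depends on the index `m` of the coefficient, but the coefficient is nonzero
  -- only where raising `m` at `j` gives `e`; there the factor is the constant `lookup e j`.
  ∂-monomial : (j : Fin K) (e : Vec ℕ K) → ∂ j (monomial e) ≋ lookup e j ·ˢ.× shift j (monomial e)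
  ∂-monomial j e m rewrite ·-apply (lookup e j) (shift j (monomial e)) m
    with (m [ j ]%= suc) ≟ᵛ e
  ... | yes refl = reflexive (cong (_· 1#) (sym (Vec.lookup∘updateAt j m)))
  ... | no _ = ≈-trans (·-zero (suc (lookup m j))) (≈-sym (·-zero (lookup e j)))

  -- Additive operators on series, which pass through finite sums.

  record Additive {K L : ℕ} (T : Series K → Series L) : Set (c ⊔ ℓ) where
    field
      ≋-cong : ∀ {F G} → F ≋ G → T F ≋ T G
      0-homo : T (λ _ → 0#) ≋ λ _ → 0#
      +-homo : ∀ F G → T (λ m → F m + G m) ≋ λ m → T F m + T G m

    sum-homo : (F : Fin n → Series K) → T (Σˢ.sum F) ≋ Σˢ.sum (T ∘ F)
    sum-homo {zero}  F = 0-homo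
    sum-homo {suc n} F = +ˢ.trans (+-homo _ _) (+ˢ.∙-congˡ (sum-homo (F ∘ suc)))

  open Additive

  ∘-additive : ∀ {K L N} {T : Series L → Series N} {U : Series K → Series L} →
               Additive T → Additive U → Additive (T ∘ U)
  ∘-additive T U = record
    { ≋-cong = ≋-cong T ∘ ≋-cong U
    ; 0-homo = +ˢ.trans (≋-cong T (0-homo U)) (0-homo T)
    ; +-homo = λ F G → +ˢ.trans (≋-cong T (+-homo U F G)) (+-homo T _ _)
    }

  sum-additive : ∀ {K L} {T : Fin n → Series K → Series L} → (∀ j → Additive (T j)) →
                 Additive (λ F → Σˢ.sum λ j → T j F)
  sum-additive {n} {T = T} T-additive = record
    { ≋-cong = λ e → Σˢ.sum-cong-≋ λ j → ≋-cong (T-additive j) e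
    ; 0-homo = +ˢ.trans (Σˢ.sum-cong-≋ λ j → 0-homo (T-additive j)) (Σˢ.sum-replicate-zero n)
    ; +-homo = λ F G → +ˢ.trans (Σˢ.sum-cong-≋ λ j → +-homo (T-additive j) F G)
                               (Σˢ.∑-distrib-+ (λ j → T j F) (λ j → T j G))
    }

  ∂-additive : (j : Fin K) → Additive (∂ j)
  ∂-additive j = record
    { ≋-cong = λ e m → ×-congʳ (suc (lookup m j)) (e (m [ j ]%= suc))
    ; 0-homo = λ m → ·-zero (suc (lookup m j))
    ; +-homo = λ F G m → ·-distrib-+ _ _ (suc (lookup m j))
    }

  include-additive : Additive (include {K})
  include-additive = record { ≋-cong = cong′ ; 0-homo = zero′ ; +-homo = plus′ }
    where
    cong′ : ∀ {F G} → F ≋ G → include F ≋ include G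
    cong′ e m with does (last m ℕ.≟ 0)
    ... | true  = e (init m)
    ... | false = ≈-refl

    zero′ : include (λ _ → 0#) ≋ λ _ → 0#
    zero′ m with does (last m ℕ.≟ 0)
    ... | true  = ≈-refl
    ... | false = ≈-refl

    plus′ : ∀ F G → include (λ m → F m + G m) ≋ λ m → include F m + include G m
    plus′ F G m with does (last m ℕ.≟ 0)
    ... | true  = ≈-refl
    ... | false = ≈-sym (+-identityˡ 0#)

  ·ᶜ-additive : (F : Series K) → Additive (F ·ᶜ_)
  ·ᶜ-additive F = record
    { ≋-cong = ·ᶜ-cong (λ _ → ≈-refl)
    ; 0-homo = convolve-zero λ a b → zeroʳ (F a)
    ; +-homo = λ G H → +ˢ.trans (convolve-cong λ a b → distribˡ (F a) (G b) (H b)) (convolve-+ _ _)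
    }

  -- The operator `𝒟` on monomials.

  x·include : Fin K → Series K → Series (suc K)
  x·include j F = x (suc j) ·ᶜ include F

  x·include-additive : (j : Fin K) → Additive (x·include j)
  x·include-additive j = ∘-additive (·ᶜ-additive (x (suc j))) include-additive

  𝒟-additive : ∀ K → Additive (𝒟 K)
  𝒟-additive K = sum-additive λ j → ∘-additive (x·include-additive j) (∂-additive j)

  x·include-shift : (c : Fin n → Fin K) (i : Fin n) →
    x·include (c i) (shift (c i) (monomial (content c))) ≋ monomial (content (bump c i))
  x·include-shift {suc n} c i = begin
    x·include (c i) (shift (c i) (monomial (content c)))
      ≡⟨ cong (λ e → x·include (c i) (shift (c i) (monomial e))) (content-remove c i) ⟩
    x·include (c i) (shift (c i) (monomial (unit (c i) ⊕ content (c ∘ punchIn i))))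
      ≈⟨ ≋-cong (x·include-additive (c i)) (shift-monomial (c i) _) ⟩
    x·include (c i) (monomial (content (c ∘ punchIn i)))
      ≈⟨ ·ᶜ-cong (λ _ → ≈-refl) (include-monomial _) ⟩
    x (suc (c i)) ·ᶜ monomial (content (c ∘ punchIn i) ∷ʳ 0)
      ≈⟨ monomial-· (unit (suc (c i))) _ ⟩
    monomial (unit (suc (c i)) ⊕ (content (c ∘ punchIn i) ∷ʳ 0))
      ≡⟨ cong monomial (content-bump c i) ⟨
    monomial (content (bump c i)) ∎
    where open ≋-Reasoning

  -- The exponent of `x j` is the number of factors coloured `j`, so the derivative becomes a sum
  -- over those factors. After exchanging the sums, factor `i` meets only `j = c i`, where it is
  -- bumped.
  𝒟-monomial : (c : Fin n → Fin K) →
    𝒟 K (monomial (content c)) ≋ Σˢ.sum λ i → monomial (content (bump c i))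
  𝒟-monomial {n} {K} c = begin
    Σˢ.sum (λ j → x·include j (∂ j (monomial (content c))))
      ≈⟨ Σˢ.sum-cong-≋ (λ j → ≋-cong (x·include-additive j) (+ˢ.trans (∂-monomial j (content c))
           (+ˢ.sym (sum-indicator (+-series-commutativeMonoid K) c j (G j))))) ⟩
    Σˢ.sum (λ j → x·include j (Σˢ.sum λ i → term i j))
      ≈⟨ Σˢ.sum-cong-≋ (λ j → sum-homo (x·include-additive j) (λ i → term i j)) ⟩
    Σˢ.sum (λ j → Σˢ.sum λ i → x·include j (term i j))
      ≈⟨ Σˢ.∑-comm (λ j i → x·include j (term i j)) ⟩
    Σˢ.sum (λ i → Σˢ.sum λ j → x·include j (term i j))
      ≈⟨ Σˢ.sum-cong-≋ (λ i → +ˢ.trans (Σˢ.sum-cong-≋ (x·include-term i))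
           (sum-δ (+-series-commutativeMonoid (suc K)) (c i) (monomial (content (bump c i))))) ⟩
    Σˢ.sum (λ i → monomial (content (bump c i))) ∎
    where
    open ≋-Reasoning
    G : Fin K → Series K
    G j = shift j (monomial (content c))

    term : Fin n → Fin K → Series K
    term i j = if does (c i Fin.≟ j) then G j else λ _ → 0#

    x·include-term : ∀ i j → x·include j (term i j) ≋
      (if does (c i Fin.≟ j) then monomial (content (bump c i)) else λ _ → 0#)
    x·include-term i j with c i Fin.≟ j
    ... | yes refl = x·include-shift c i
    ... | no _     = 0-homo (x·include-additive j)

  -- The expansion over functions, by induction on `k`.

  functionMonomial : ∀ k n → Fin (n ^ℕ k) → Series (suc k)
  functionMonomial k n i = monomial (content (fibreSize (finToFun {n} {k} i)))

  Δ-x₀^n : ∀ k n → Δ k (x zero ^ n) ≋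
    Σˢ.sum (functionMonomial k n)
  Δ-x₀^n zero n = begin
    x zero ^ n                           ≈⟨ x-^ zero n ⟩
    -- For `k = 0` there is one function, and every fibre size lies in the one-element `Fin 1`.
    monomial (content {n} λ _ → zero)    ≡⟨ cong monomial (content-cong (zero≡_ ∘ fibreSize f₀)) ⟩
    functionMonomial 0 n zero            ≈⟨ +ˢ.identityʳ _ ⟨
    Σˢ.sum (functionMonomial 0 n)        ∎
    where
    open ≋-Reasoning
    f₀ = finToFun {n} {0} zero

    zero≡_ : (i : Fin 1) → zero ≡ i
    zero≡ zero = refl
  Δ-x₀^n (suc k) n = begin
    𝒟 (suc k) (Δ k (x zero ^ n))
      ≈⟨ ≋-cong (𝒟-additive (suc k)) (Δ-x₀^n k n) ⟩
    𝒟 (suc k) (Σˢ.sum (functionMonomial k n))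
      ≈⟨ sum-homo (𝒟-additive (suc k)) (functionMonomial k n) ⟩
    Σˢ.sum (λ f → 𝒟 (suc k) (functionMonomial k n f))
      ≈⟨ Σˢ.sum-cong-≋ (λ f → 𝒟-monomial (fibreSize (finToFun {n} {k} f))) ⟩
    Σˢ.sum (λ f → Σˢ.sum λ i → bumpMonomial i f)
      -- The bumped factor `i`, which is the value at the new point, becomes the outer index,
      -- matching the order of `combine`.
      ≈⟨ Σˢ.∑-comm (λ f i → bumpMonomial i f) ⟩
    Σˢ.sum (λ i → Σˢ.sum (bumpMonomial i))
      ≈⟨ Σˢ.sum-cong-≋ (λ i → Σˢ.sum-cong-≋ {x = consMonomial i} {bumpMonomial i} λ f →
           +ˢ.reflexive (cong monomial (content-cong (fibreSize-combine {n} {k} i f)))) ⟨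
    Σˢ.sum (λ i → Σˢ.sum (consMonomial i))
      ≈⟨ sum-combine (+-series-commutativeMonoid (suc (suc k))) n (n ^ℕ k) (functionMonomial (suc k) n) ⟨
    Σˢ.sum (functionMonomial (suc k) n) ∎
    where
    open ≋-Reasoning
    bumpMonomial consMonomial : Fin n → Fin (n ^ℕ k) → Series (suc (suc k))
    bumpMonomial i f = monomial (content (bump (fibreSize (finToFun {n} {k} f)) i))
    consMonomial i f = functionMonomial (suc k) n (combine i f)

  Δ-x₀^n-sum-w : ∀ k n → Δ k (x zero ^ n) ≋ sumOverFunctions k n w
  Δ-x₀^n-sum-w k n = +ˢ.trans (Δ-x₀^n k n)
    (Σˢ.sum-cong-≋ {n = n ^ℕ k} λ i → +ˢ.sym (product-x (fibreSize (finToFun {n} {k} i))))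

  -- Exponential coefficients of the expansion.

  coefficientAt-Δ : ∀ {v ℓ′} n (C : ColoredSet v ℓ′ k) →
    coefficientAt (Δ k (x zero ^ n)) C ≈ fromℕ (ℕ-Sum.sum {n ^ℕ k} λ i →
      colourPreservingCount (fibreSize (finToFun {n} {k} i)) (ColoredSet.κ C ∘ Inverse.to (ColoredSet.enum C)))
  coefficientAt-Δ {k} n C = begin
    factorials multiplicities · Δ k (x zero ^ n) multiplicities
      ≡⟨ cong (λ m → factorials m · Δ k (x zero ^ n) m) (tabulate-fibre κ′) ⟩
    factorials μ · Δ k (x zero ^ n) μ
      ≈⟨ ×-congʳ (factorials μ) (Δ-x₀^n k n μ) ⟩
    factorials μ · Σˢ.sum (monomial ∘ e) μ
      ≡⟨ cong (factorials μ ·_) (sum-apply (monomial ∘ e) μ) ⟩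
    factorials μ · Σᴿ.sum (λ i → monomial (e i) μ)
      ≈⟨ ·-distrib-sum (factorials μ) (λ i → monomial (e i) μ) ⟩
    Σᴿ.sum (λ i → factorials μ · monomial (e i) μ)
      -- The indicator from the monomial is the test in `colourPreservingCount`, and the exponential
      -- normalisation supplies its factorials.
      ≈⟨ Σᴿ.sum-cong-≋ (λ i → ·-⟦⟧ (does (μ ≟ᵛ e i))) ⟩
    Σᴿ.sum (λ i → fromℕ (if does (μ ≟ᵛ e i) then factorials μ else 0))
      ≈⟨ fromℕ-sum (λ i → if does (μ ≟ᵛ e i) then factorials μ else 0) ⟨
    fromℕ (ℕ-Sum.sum λ i → if does (μ ≟ᵛ e i) then factorials μ else 0) ∎
    where
    open SetoidReasoning setoid
    open ColoredSet C using (κ; enum; multiplicities)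
    κ′ = κ ∘ Inverse.to enum
    μ = content κ′

    e : Fin (n ^ℕ k) → Vec ℕ (suc k)
    e i = content (fibreSize (finToFun {n} {k} i))

    ·-⟦⟧ : ∀ b → factorials μ · ⟦ b ⟧ ≈ fromℕ (if b then factorials μ else 0)
    ·-⟦⟧ true  = ≈-refl
    ·-⟦⟧ false = ·-zero (factorials μ)

corollary3 : ∀ {c ℓ v ℓ′} (R : CommutativeRing c ℓ) (k n : ℕ) → 1 ≤ k → 1 ≤ n →
    let open CommutativeRing R using (_≈_)
        open PowerSeries R
    in (Δ k (x zero ^ n) ≋ sumOverFunctions k n w)
       × ((C : ColoredSet v ℓ′ k) →
          ∃[ N ] (HasCardinality (compatiblePairs n C) N
                  × coefficientAt (Δ k (x zero ^ n)) C ≈ fromℕ N))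
corollary3 R k n _ _ =
  -- The inferred `N` is the sum over all `f` of the number of bijections carrying the colouring by
  -- fibre sizes to `κ`.
  Δ-x₀^n-sum-w R k n , λ C → _ , compatiblePairs-hasCardinality n C , coefficientAt-Δ R n C
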